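{- Let $F(q,x)$ be the coefficient of $z^0$ in the formal expansion of $$\prod_{i=0}^{\infty}(1+zq^{i+1})(1+z^{ -1}x^{i}),$$ a formal power series in $q$ and $x$. Then for every nonnegative integer $n$, $f(n)$ equals the sum of the coefficients of $q^m x^r$ in $F(q,x)$ over all pairs of nonnegative integers $(m,r)$ with $m+r=n$ and $m\le r$.
   Context: A Frobenius partition is a two-row array $\begin{pmatrix} a_1&a_2&\cdots&a_k\\ b_1&b_2&\cdots&b_k\end{pmatrix}$ of nonnegative integers with $k\ge 0$, $a_1>a_2>\cdots>a_k\ge 0$ and $b_1>b_2>\cdots>b_k\ge 0$; its weight is $k+\sum_{i=1}^k a_i+\sum_{i=1}^k b_i$. The empty array ($k=0$) is the unique Frobenius partition of weight $0$. $f(n)$ is the number of Frobenius partitions of weight $n$ satisfying $k+\sum_{i=1}^{k}a_i\le\sum_{i=1}^{k}b_i$. -}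

module Defs where

open import Data.Fin.Base using (Fin)
open import Data.Integer.Base as ℤ using (ℤ; 0ℤ; 1ℤ; -1ℤ)
import Data.Integer.Properties as ℤ
open import Data.List.Base as List
  using (List; []; _∷_; [_]; _++_; cartesianProduct; cartesianProductWith;
         concatMap; deduplicate; filter; foldr; length; lookup; map; upTo)
open import Data.List.Membership.Propositional using (_∈_)
open import Data.List.Membership.Propositional.Properties
  using (∈-cartesianProduct⁺; ∈-cartesianProductWith⁺; ∈-concat⁺′;
         ∈-deduplicate⁺; ∈-deduplicate⁻; ∈-filter⁺; ∈-filter⁻; ∈-lookup;
         ∈-map⁺; ∈-upTo⁺)
import Data.List.Properties as List
open import Data.List.Relation.Unary.All as All using (All)
import Data.List.Relation.Unary.AllPairs as AllPairs
open import Data.List.Relation.Unary.Any as Any using (here)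
open import Data.List.Relation.Unary.Any.Properties using (lookup-index)
open import Data.List.Relation.Unary.Unique.Propositional using (Unique)
open import Data.List.Relation.Unary.Unique.DecPropositional.Properties
  using (deduplicate-!)
open import Data.Nat.Base
open import Data.Nat.Properties
open import Data.Product.Base using (Σ; ∃; _×_; _,_; proj₁; proj₂)
open import Data.Product.Properties using (≡-dec)
open import Data.Vec.Base as Vec using (Vec; []; _∷_)
import Data.Vec.Properties as Vec
open import Data.Vec.Relation.Unary.Linked as Linked using (Linked)
open import Function.Base using (_∘_)
open import Function.Bundles using (_↔_; mk↔ₛ′)
open import Relation.Binary.Definitions using (DecidableEquality)
open import Relation.Binary.PropositionalEquality
  using (_≡_; _≢_; refl; sym; trans; cong; cong₂; module ≡-Reasoning)
open import Relation.Nullary.Decidable using (yes; no; _×-dec_)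
open import Relation.Nullary.Negation using (contradiction)
import Relation.Unary as U

Array : Set
Array = Σ ℕ λ k → Vec ℕ k × Vec ℕ k

IsFrobenius : Array → Set
IsFrobenius (k , a , b) = Linked _>_ a × Linked _>_ b

weight : Array → ℕ
weight (k , a , b) = k + Vec.sum a + Vec.sum b

TopAtMostBottom : Array → Set
TopAtMostBottom (k , a , b) = k + Vec.sum a ≤ Vec.sum b

Counted : ℕ → Array → Set
Counted n π = IsFrobenius π × weight π ≡ n × TopAtMostBottom π

private
  _≟ᴬ_ : DecidableEquality Array
  _≟ᴬ_ = ≡-dec _≟_ (≡-dec (Vec.≡-dec _≟_) (Vec.≡-dec _≟_))

  counted? : ∀ n → U.Decidable (Counted n)
  counted? n (k , a , b) =
    (Linked.linked? _>?_ a ×-dec Linked.linked? _>?_ b)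
    ×-dec (weight (k , a , b) ≟ n)
    ×-dec (k + Vec.sum a ≤? Vec.sum b)

  counted-irrelevant : ∀ n → U.Irrelevant (Counted n)
  counted-irrelevant n ((p , q) , r , s) ((p′ , q′) , r′ , s′) =
    cong₂ _,_
      (cong₂ _,_ (Linked.irrelevant ≤-irrelevant p p′)
                 (Linked.irrelevant ≤-irrelevant q q′))
      (cong₂ _,_ (≡-irrelevant r r′) (≤-irrelevant s s′))

  boundedVecs : ∀ n k → List (Vec ℕ k)
  boundedVecs n zero    = [ [] ]
  boundedVecs n (suc k) =
    cartesianProductWith _∷_ (upTo (suc n)) (boundedVecs n k)

  ∈-boundedVecs : ∀ {n k} (v : Vec ℕ k) → Vec.sum v ≤ n → v ∈ boundedVecs n k
  ∈-boundedVecs []      _ = here refl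
  ∈-boundedVecs (x ∷ v) h =
    ∈-cartesianProductWith⁺ _∷_
      (∈-upTo⁺ (s≤s (m+n≤o⇒m≤o x h)))
      (∈-boundedVecs v (m+n≤o⇒n≤o x h))

  arraysOfWidth : ℕ → ℕ → List Array
  arraysOfWidth n k =
    map (k ,_) (cartesianProduct (boundedVecs n k) (boundedVecs n k))

  boundedArrays : ℕ → List Array
  boundedArrays n = concatMap (arraysOfWidth n) (upTo (suc n))

  ∈-boundedArrays : ∀ {n} π → weight π ≡ n → π ∈ boundedArrays n
  ∈-boundedArrays π@(k , a , b) refl =
    ∈-concat⁺′
      (∈-map⁺ (k ,_)
        (∈-cartesianProduct⁺
          (∈-boundedVecs a (≤-trans (m≤n+m _ k) (m≤m+n _ _)))
          (∈-boundedVecs b (m≤n+m _ _))))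
      (∈-map⁺ (arraysOfWidth (weight π))
        (∈-upTo⁺ (s≤s (≤-trans (m≤m+n k _) (m≤m+n _ _)))))

  lookup-injective : ∀ {A : Set} {xs : List A} → Unique xs →
                     ∀ i j → lookup xs i ≡ lookup xs j → i ≡ j
  lookup-injective (_   AllPairs.∷ _) Fin.zero    Fin.zero    _  = refl
  lookup-injective (x∉  AllPairs.∷ _) Fin.zero    (Fin.suc j) eq =
    contradiction eq (All.lookup x∉ (∈-lookup j))
  lookup-injective (x∉  AllPairs.∷ _) (Fin.suc i) Fin.zero    eq =
    contradiction (sym eq) (All.lookup x∉ (∈-lookup i))
  lookup-injective (_   AllPairs.∷ u) (Fin.suc i) (Fin.suc j) eq =
    cong Fin.suc (lookup-injective u i j eq)

  Fin↔subtype : ∀ {A : Set} {P : A → Set} {xs : List A} → U.Irrelevant P →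
                Unique xs → (∀ {x} → x ∈ xs → P x) → (∀ {x} → P x → x ∈ xs) →
                Fin (length xs) ↔ Σ A P
  Fin↔subtype {A} {P} {xs} irr uniq sound complete = mk↔ₛ′
    (λ i → lookup xs i , sound (∈-lookup i))
    (λ (_ , p) → Any.index (complete p))
    (λ (_ , p) → subtype-≡ (sym (lookup-index (complete p))))
    (λ i → lookup-injective uniq _ i
             (sym (lookup-index (complete (sound (∈-lookup i))))))
    where
    subtype-≡ : ∀ {u v : Σ A P} → proj₁ u ≡ proj₁ v → u ≡ v
    subtype-≡ {x , _} refl = cong (x ,_) (irr _ _)

counted-finite : ∀ n → ∃ λ c → Fin c ↔ Σ Array (Counted n)
counted-finite n = length xs ,
  Fin↔subtype (counted-irrelevant n) (deduplicate-! _≟ᴬ_ ys)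
    (λ x∈ → proj₂ (∈-filter⁻ (counted? n) {xs = boundedArrays n}
                    (∈-deduplicate⁻ _≟ᴬ_ ys x∈)))
    (λ {π} p → ∈-deduplicate⁺ _≟ᴬ_
                 (∈-filter⁺ (counted? n) (∈-boundedArrays π (proj₁ (proj₂ p))) p))
  where
  ys = filter (counted? n) (boundedArrays n)
  xs = deduplicate _≟ᴬ_ ys

f : ℕ → ℕ
f n = proj₁ (counted-finite n)

sumℤ : List ℤ → ℤ
sumℤ = foldr ℤ._+_ 0ℤ

-- (k , m , r) stands for zᵏ qᵐ xʳ.
Monomial : Set
Monomial = ℤ × ℕ × ℕ

infix 4 _≟ᴹ_
_≟ᴹ_ : DecidableEquality Monomial
_≟ᴹ_ = ≡-dec ℤ._≟_ (≡-dec _≟_ _≟_)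

infixl 7 _·_
_·_ : Monomial → Monomial → Monomial
(k , m , r) · (k′ , m′ , r′) = k ℤ.+ k′ , m + m′ , r + r′

-- A formal sum of terms.  The same monomial may occur several times, so
-- a polynomial should only be inspected through its coefficients.
Polynomial : Set
Polynomial = List (ℤ × Monomial)

coeff : Polynomial → Monomial → ℤ
coeff p e = sumℤ (map proj₁ (filter (λ t → proj₂ t ≟ᴹ e) p))

infixl 6 _⊕_
_⊕_ : Polynomial → Polynomial → Polynomial
_⊕_ = _++_

infixl 7 _⊗_
_⊗_ : Polynomial → Polynomial → Polynomial
_⊗_ = cartesianProductWith λ (c , d) (c′ , d′) → c ℤ.* c′ , d · d′

monomial : Monomial → Polynomial
monomial d = [ 1ℤ , d ]

one : Polynomial
one = monomial (0ℤ , 0 , 0)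

-- (1 + z qⁱ⁺¹) (1 + z⁻¹ xⁱ)
factor : ℕ → Polynomial
factor i = (one ⊕ monomial (1ℤ , suc i , 0)) ⊗ (one ⊕ monomial (-1ℤ , 0 , i))

partialProduct : ℕ → Polynomial
partialProduct zero    = one
partialProduct (suc N) = partialProduct N ⊗ factor N

EventuallyEquals : (ℕ → ℤ) → ℤ → Set
EventuallyEquals s c = ∃ λ N₀ → ∀ N → N₀ ≤ N → s N ≡ c

private
  coeff-++ : ∀ p p′ e → coeff (p ++ p′) e ≡ coeff p e ℤ.+ coeff p′ e
  coeff-++ []            p′ e = sym (ℤ.+-identityˡ _)
  coeff-++ ((c , d) ∷ p) p′ e with d ≟ᴹ e
  ... | yes _ = trans (cong (λ u → c ℤ.+ u) (coeff-++ p p′ e)) (sym (ℤ.+-assoc c _ _))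
  ... | no  _ = coeff-++ p p′ e

  coeff-none : ∀ p {e} → All (λ t → proj₂ t ≢ e) p → coeff p e ≡ 0ℤ
  coeff-none _ {e} none =
    cong (sumℤ ∘ map proj₁) (List.filter-none (λ t → proj₂ t ≟ᴹ e) none)

  >⇒+≢ : ∀ {n m} a → m < n → a + n ≢ m
  >⇒+≢ {n} a m<n eq = <⇒≢ (<-≤-trans m<n (m≤n+m n a)) (sym eq)

  coeff-⊗-factor : ∀ p {k m r n} → m < n → r < n →
                   coeff (p ⊗ factor n) (k , m , r) ≡ coeff p (k , m , r)
  coeff-⊗-factor []                      m<n r<n = refl
  coeff-⊗-factor (t@(c , i , j , l) ∷ p) {k} {m} {r} {n} m<n r<n = begin
    coeff (terms ++ p ⊗ factor n) e            ≡⟨ coeff-++ terms (p ⊗ factor n) e ⟩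
    coeff terms e ℤ.+ coeff (p ⊗ factor n) e   ≡⟨ cong₂ ℤ._+_ terms-≡ (coeff-⊗-factor p m<n r<n) ⟩
    coeff [ t ] e ℤ.+ coeff p e                ≡⟨ coeff-++ [ t ] p e ⟨
    coeff (t ∷ p) e                            ∎
    where
    open ≡-Reasoning
    e = k , m , r
    terms = [ t ] ⊗ factor n

    q-large : ∀ {k′ r′} → (k′ , j + (suc n + 0) , r′) ≢ e
    q-large eq =
      >⇒+≢ j (<-≤-trans m<n (≤-trans (n≤1+n n) (m≤m+n _ 0))) (cong (proj₁ ∘ proj₂) eq)

    x-large : ∀ {k′ m′} → (k′ , m′ , l + n) ≢ e
    x-large eq = >⇒+≢ l r<n (cong (proj₂ ∘ proj₂) eq)

    unit : (c ℤ.* 1ℤ , (i ℤ.+ 0ℤ , j + 0 , l + 0)) ≡ t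
    unit = cong₂ _,_ (ℤ.*-identityʳ c)
             (cong₂ _,_ (ℤ.+-identityʳ i) (cong₂ _,_ (+-identityʳ j) (+-identityʳ l)))

    terms-≡ : coeff terms e ≡ coeff [ t ] e
    terms-≡ = begin
      coeff terms e                                   ≡⟨ coeff-++ (List.take 1 terms) (List.drop 1 terms) e ⟩
      coeff (List.take 1 terms) e
        ℤ.+ coeff (List.drop 1 terms) e               ≡⟨ cong₂ ℤ._+_ (cong (λ u → coeff [ u ] e) unit) rest-≡ ⟩
      coeff [ t ] e ℤ.+ 0ℤ                            ≡⟨ ℤ.+-identityʳ _ ⟩
      coeff [ t ] e                                   ∎
      where
      rest-≡ : coeff (List.drop 1 terms) e ≡ 0ℤ
      rest-≡ = coeff-none (List.drop 1 terms)
        (x-large All.∷ q-large All.∷ q-large All.∷ All.[])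

coeff-stabilises : ∀ e → ∃ (EventuallyEquals (λ N → coeff (partialProduct N) e))
coeff-stabilises e@(k , m , r) = coeff (partialProduct N₀) e , N₀ , λ N → go ∘ ≤⇒≤′
  where
  N₀ = suc (m ⊔ r)

  go : ∀ {N} → N₀ ≤′ N → coeff (partialProduct N) e ≡ coeff (partialProduct N₀) e
  go ≤′-refl             = refl
  go (≤′-step {N} N₀≤′N) = trans
    (coeff-⊗-factor (partialProduct N)
      (≤-trans (s≤s (m≤m⊔n m r)) (≤′⇒≤ N₀≤′N))
      (≤-trans (s≤s (m≤n⊔m m r)) (≤′⇒≤ N₀≤′N)))
    (go N₀≤′N)

-- The product over all i ≥ 0, each coefficient being the limit of the
-- corresponding coefficients of the partial products.
infiniteProduct : Monomial → ℤ
infiniteProduct e = proj₁ (coeff-stabilises e)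

-- Coefficient of qᵐ xʳ in F(q, x), the coefficient of z⁰ in the product.
F : ℕ → ℕ → ℤ
F m r = infiniteProduct (0ℤ , m , r)

-- The range loses no pair: m + r ≡ n bounds both entries by n.
admissiblePairs : ℕ → List (ℕ × ℕ)
admissiblePairs n =
  filter (λ (m , r) → (m + r ≟ n) ×-dec (m ≤? r))
         (cartesianProduct (upTo (suc n)) (upTo (suc n)))

{-# OPTIONS --safe #-}

-- Expanding the first N factors without collecting terms, a term picks from each
-- factor i whether to take z qⁱ⁺¹ and whether to take z⁻¹ xⁱ.  The picked indices,
-- listed downwards, are two strictly decreasing rows a and b below N, and the term
-- is z^(|a|−|b|) q^(|a|+Σa) x^(Σb).  All scalars are 1, so coefficients count terms;
-- the terms free of z are the Frobenius partitions with entries below N, and in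
-- weight n all entries are at most n.
module Submission where

open import Defs
open import Data.Bool.Base using (Bool; true; false)
open import Data.Fin.Base using (Fin)
open import Data.Integer.Base as ℤ using (ℤ; +_; 0ℤ; 1ℤ; -1ℤ; _⊖_)
import Data.Integer.Properties as ℤ
open import Data.List.Base
  using (List; []; _∷_; _++_; cartesianProduct; cartesianProductWith; filter;
         length; map; tabulate; upTo)
open import Data.List.Membership.Propositional using (_∈_)
open import Data.List.Membership.Propositional.Properties
open import Data.List.Membership.Propositional.Properties.WithK using (unique∧set⇒bag)
import Data.List.Properties as List
open import Data.List.Relation.Binary.BagAndSetEquality using (∼bag⇒↭)
open import Data.List.Relation.Binary.Permutation.Propositional.Properties using (↭-length)
open import Data.List.Relation.Unary.All as All using ([]; _∷_)
open import Data.List.Relation.Unary.AllPairs using ([]; _∷_)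
open import Data.List.Relation.Unary.Any using (here; there)
open import Data.List.Relation.Unary.Unique.Propositional using (Unique)
import Data.List.Relation.Unary.Unique.Propositional.Properties as Unique
open import Data.Nat.Base
open import Data.Nat.ListAction using (sum)
open import Data.Nat.Properties
open import Data.Product.Base using (∃; _×_; _,_; proj₁; proj₂; map₂)
open import Data.Vec.Base as Vec using (Vec; []; _∷_; toList; fromList)
import Data.Vec.Properties as Vec
open import Data.Vec.Relation.Unary.Linked as Linked using (Linked; []; [-]; _∷_)
open import Function.Base using (_∘_)
open import Function.Properties.Inverse using (↔⇒↣)
open import Function.Bundles using (mk⇔; module Injection; module Inverse)
open import Relation.Binary.PropositionalEquality
open import Relation.Nullary.Decidable using (yes; no; _×-dec_)
open import Relation.Nullary.Negation using (contradiction)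
import Relation.Unary as U

-- Lists and vectors

-- Tracks a product of two expansions term by term: if each is the image of a list of choices, so is
-- the product, over pairs of choices combined by `l`.
cartesianProductWith-map : ∀ {A A′ B B′ C C′ : Set}
  {f : A′ → B′ → C′} {g : A → A′} {h : B → B′} {k : C → C′} {l : A → B → C} →
  (∀ x y → f (g x) (h y) ≡ k (l x y)) → ∀ xs ys →
  cartesianProductWith f (map g xs) (map h ys) ≡ map k (cartesianProductWith l xs ys)
cartesianProductWith-map eq []       ys = refl
cartesianProductWith-map {f = f} {g} {h} {k} {l} eq (x ∷ xs) ys =
  trans
    (cong₂ _++_
      (trans (sym (List.map-∘ ys)) (trans (List.map-cong (eq x) ys) (List.map-∘ ys)))
      (cartesianProductWith-map eq xs ys))
    (sym (List.map-++ k (map (l x) ys) (cartesianProductWith l xs ys)))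

length-filter-map : ∀ {A B : Set} {P : B → Set} (P? : U.Decidable P) (g : A → B) xs →
  length (filter P? (map g xs)) ≡ length (filter (P? ∘ g) xs)
length-filter-map P? g []       = refl
length-filter-map P? g (x ∷ xs) with P? (g x)
... | yes _ = cong suc (length-filter-map P? g xs)
... | no  _ = length-filter-map P? g xs

-- Each summand counts the pairs with a given first entry; this turns a sum of coefficients into the
-- length of one list.
sumℤ-length-filter : ∀ {A B : Set} {P : A × B → Set} (P? : U.Decidable P) xs ys →
  sumℤ (map (λ x → + length (filter (λ y → P? (x , y)) ys)) xs) ≡
  + length (filter P? (cartesianProduct xs ys))
sumℤ-length-filter P? []       ys = refl
sumℤ-length-filter P? (x ∷ xs) ys = begin
  + length (filter (λ y → P? (x , y)) ys) ℤ.+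
    sumℤ (map (λ x → + length (filter (λ y → P? (x , y)) ys)) xs)
    ≡⟨ cong₂ ℤ._+_ (cong +_ (sym (length-filter-map P? (x ,_) ys)))
                   (sumℤ-length-filter P? xs ys) ⟩
  + (length (filter P? row) + length (filter P? rest))
    ≡⟨ cong +_ (List.length-++ (filter P? row)) ⟨
  + length (filter P? row ++ filter P? rest)
    ≡⟨ cong (λ zs → + length zs) (List.filter-++ P? row rest) ⟨
  + length (filter P? (row ++ rest)) ∎
  where
  open ≡-Reasoning
  row  = map (x ,_) ys
  rest = cartesianProduct xs ys

-- Without repetitions, equality as sets is equality as bags, hence a permutation.
length-unique : ∀ {A : Set} {xs ys : List A} → Unique xs → Unique ys →
  (∀ {x} → x ∈ xs → x ∈ ys) → (∀ {x} → x ∈ ys → x ∈ xs) → length xs ≡ length ys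
length-unique uxs uys xs⊆ys ys⊆xs =
  ↭-length (∼bag⇒↭ (unique∧set⇒bag uxs uys (mk⇔ xs⊆ys ys⊆xs)))

sum-toList : ∀ {k} (a : Vec ℕ k) → sum (toList a) ≡ Vec.sum a
sum-toList []      = refl
sum-toList (x ∷ a) = cong (λ s → x + s) (sum-toList a)

toList-surjective : ∀ {A : Set} {k} (xs : List A) → length xs ≡ k →
  ∃ λ (a : Vec A k) → toList a ≡ xs
toList-surjective xs refl = fromList xs , Vec.toList∘fromList xs

toList-injective : ∀ {A : Set} {k} (a b : Vec A k) → toList a ≡ toList b → a ≡ b
toList-injective a b eq =
  trans (sym (Vec.cast-is-id refl a)) (Vec.toList-injective refl a b eq)

-- Strictly decreasing sequences as bit masks

-- The head bit stands for the largest index, so the chosen indices come out in decreasing order.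
decode : ∀ {N} → Vec Bool N → List ℕ
decode         []          = []
decode {suc N} (true  ∷ v) = N ∷ decode v
decode         (false ∷ v) = decode v

Linked-weaken : ∀ {N k} {a : Vec ℕ k} → Linked _>_ (N ∷ a) → Linked _>_ (suc N ∷ a)
Linked-weaken {a = []}    [-]      = [-]
Linked-weaken {a = _ ∷ _} (lt ∷ l) = m<n⇒m<1+n lt ∷ l

-- Putting `N` in front packs the bound on the entries and their strict decrease into one chain, a
-- form suited to induction on the mask.
decode⇒Linked : ∀ {N k} (a : Vec ℕ k) (v : Vec Bool N) → toList a ≡ decode v →
  Linked _>_ (N ∷ a)
decode⇒Linked []      []          _  = [-]
decode⇒Linked a       (false ∷ v) eq = Linked-weaken (decode⇒Linked a v eq)
decode⇒Linked (x ∷ a) (true  ∷ v) eq with refl ← List.∷-injectiveˡ eq =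
  n<1+n _ ∷ decode⇒Linked a v (List.∷-injectiveʳ eq)

Linked⇒decode : ∀ N {k} (a : Vec ℕ k) → Linked _>_ (N ∷ a) →
  ∃ λ (v : Vec Bool N) → decode v ≡ toList a
Linked⇒decode zero    []      _        = [] , refl
Linked⇒decode zero    (x ∷ a) (() ∷ _)
Linked⇒decode (suc N) []      _        =
  let v , eq = Linked⇒decode N [] [-] in false ∷ v , eq
-- The first entry alone decides the bit of `N`, since all later entries are smaller.
Linked⇒decode (suc N) (x ∷ a) (lt ∷ l) with x ≟ N
... | yes refl = let v , eq = Linked⇒decode N a l in true ∷ v , cong (N ∷_) eq
... | no  x≢N  =
  let v , eq = Linked⇒decode N (x ∷ a) (≤∧≢⇒< (s≤s⁻¹ lt) x≢N ∷ l) in false ∷ v , eq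

-- Entries decoded from `N` bits lie below `N`; a first entry `N` would give `N > N`.
N∷-≢-decode : ∀ {N} l (v : Vec Bool N) → N ∷ l ≢ decode v
N∷-≢-decode {N} l v eq = <-irrefl refl
  (Linked.head (decode⇒Linked (N ∷ fromList l) v
                 (trans (cong (N ∷_) (Vec.toList∘fromList l)) eq)))

decode-injective : ∀ {N} (u v : Vec Bool N) → decode u ≡ decode v → u ≡ v
decode-injective []          []          _  = refl
decode-injective (false ∷ u) (false ∷ v) eq = cong (false ∷_) (decode-injective u v eq)
decode-injective (false ∷ u) (true  ∷ v) eq = contradiction (sym eq) (N∷-≢-decode _ u)
decode-injective (true  ∷ u) (false ∷ v) eq = contradiction eq (N∷-≢-decode _ v)
decode-injective (true  ∷ u) (true  ∷ v) eq =
  cong (true ∷_) (decode-injective u v (List.∷-injectiveʳ eq))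

-- Expansion of the partial products

bits : List Bool
bits = false ∷ true ∷ []

Mask : ℕ → Set
Mask N = Vec Bool N × Vec Bool N

extend : ∀ {N} → Mask N → Bool × Bool → Mask (suc N)
extend (u , v) (s , t) = s ∷ u , t ∷ v

-- The order follows that of the terms in `_⊗_`, so that the expansion becomes an equality of lists.
masks : ∀ N → List (Mask N)
masks zero    = ([] , []) ∷ []
masks (suc N) = cartesianProductWith extend (masks N) (cartesianProduct bits bits)

∈-bits : ∀ s → s ∈ bits
∈-bits false = here refl
∈-bits true  = there (here refl)

∈-masks : ∀ {N} (p : Mask N) → p ∈ masks N
∈-masks ([]    , [])    = here refl
∈-masks (s ∷ u , t ∷ v) = ∈-cartesianProductWith⁺ extend (∈-masks (u , v))
  (∈-cartesianProduct⁺ (∈-bits s) (∈-bits t))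

bits-unique : Unique bits
bits-unique = ((λ ()) ∷ []) ∷ [] ∷ []

masks-unique : ∀ N → Unique (masks N)
masks-unique zero    = [] ∷ []
masks-unique (suc N) = Unique.cartesianProductWith⁺ extend (λ { refl → refl , refl })
  (masks-unique N) (Unique.cartesianProduct⁺ bits-unique bits-unique)

Rows : Set
Rows = List ℕ × List ℕ

rows : ∀ {N} → Mask N → Rows
rows (u , v) = decode u , decode v

rows-injective : ∀ {N} {p p′ : Mask N} → rows p ≡ rows p′ → p ≡ p′
rows-injective {p = u , v} {u′ , v′} eq =
  cong₂ _,_ (decode-injective u u′ (cong proj₁ eq)) (decode-injective v v′ (cong proj₂ eq))

exponent : Rows → Monomial
exponent (a , b) = length a ⊖ length b , length a + sum a , sum b

term : ∀ {N} → Mask N → ℤ × Monomial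
term p = 1ℤ , exponent (rows p)

factorExponent : ℕ → Bool × Bool → Monomial
factorExponent N (false , false) = 0ℤ , 0 , 0
factorExponent N (false , true)  = -1ℤ , 0 , N
factorExponent N (true  , false) = 1ℤ , suc N , 0
factorExponent N (true  , true)  = 0ℤ , suc N , N

factor-expand : ∀ N →
  factor N ≡ map (λ s → 1ℤ , factorExponent N s) (cartesianProduct bits bits)
-- Only the exponent `suc N + 0` fails to reduce by computation.
factor-expand N rewrite +-identityʳ N = refl

-- Choosing `N` on top adds one to the length and `N` to the sum of that row, which accounts for
-- `suc N` in the power of `q`; choosing it below lowers the power of `z` by one and adds `N` to
-- that of `x`.
exponent-extend : ∀ {N} (p : Mask N) s →
  exponent (rows p) · factorExponent N s ≡ exponent (rows (extend p s))
exponent-extend {N} (u , v) = go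
  where
  a = decode u
  b = decode v

  pair : ∀ {k k′ : ℤ} {m m′ r r′ : ℕ} → k ≡ k′ → m ≡ m′ → r ≡ r′ →
         (k , m , r) ≡ (k′ , m′ , r′)
  pair refl refl refl = refl

  top : length a ⊖ length b ℤ.+ 1ℤ ≡ suc (length a) ⊖ length b
  top = trans (ℤ.distribˡ-⊖-+-pos 1 (length a) (length b))
              (cong (_⊖ length b) (+-comm (length a) 1))

  bottom : length a ⊖ length b ℤ.+ -1ℤ ≡ length a ⊖ suc (length b)
  bottom = trans (ℤ.distribˡ-⊖-+-neg 0 (length a) (length b))
                 (cong (λ j → length a ⊖ suc j) (+-identityʳ (length b)))

  both : length a ⊖ length b ℤ.+ 0ℤ ≡ suc (length a) ⊖ suc (length b)
  both = trans (ℤ.+-identityʳ _) (sym (ℤ.[1+m]⊖[1+n]≡m⊖n (length a) (length b)))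

  q-shift : (length a + sum a) + suc N ≡ suc (length a) + (N + sum a)
  q-shift = begin
    (length a + sum a) + suc N   ≡⟨ +-assoc (length a) (sum a) (suc N) ⟩
    length a + (sum a + suc N)   ≡⟨ cong (λ j → length a + j) (+-comm (sum a) (suc N)) ⟩
    length a + suc (N + sum a)   ≡⟨ +-suc (length a) (N + sum a) ⟩
    suc (length a + (N + sum a)) ∎
    where open ≡-Reasoning

  go : ∀ s → exponent (a , b) · factorExponent N s ≡ exponent (rows (extend (u , v) s))
  go (false , false) = pair (ℤ.+-identityʳ _) (+-identityʳ _) (+-identityʳ _)
  go (false , true)  = pair bottom (+-identityʳ _) (+-comm _ N)
  go (true  , false) = pair top q-shift (+-identityʳ _)
  go (true  , true)  = pair both q-shift (+-comm _ N)

partialProduct-expand : ∀ N → partialProduct N ≡ map term (masks N)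
partialProduct-expand zero    = refl
partialProduct-expand (suc N) =
  trans (cong₂ _⊗_ (partialProduct-expand N) (factor-expand N))
        (cartesianProductWith-map {h = λ s → 1ℤ , factorExponent N s}
          (λ p s → cong (1ℤ ,_) (exponent-extend p s))
          (masks N) (cartesianProduct bits bits))

-- Coefficients as numbers of masks

coeff-count : ∀ {A : Set} (g : A → Monomial) e xs →
  coeff (map (λ x → 1ℤ , g x) xs) e ≡ + length (filter (λ x → g x ≟ᴹ e) xs)
coeff-count g e []       = refl
coeff-count g e (x ∷ xs) with g x ≟ᴹ e
... | yes _ = cong (λ c → 1ℤ ℤ.+ c) (coeff-count g e xs)
... | no  _ = coeff-count g e xs

coeff-partialProduct : ∀ N e →
  coeff (partialProduct N) e ≡ + length (filter (λ p → exponent (rows p) ≟ᴹ e) (masks N))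
coeff-partialProduct N e =
  trans (cong (λ p → coeff p e) (partialProduct-expand N))
        (coeff-count (exponent ∘ rows) e (masks N))

F-partialProduct : ∀ {n} m r → m ≤ n → r ≤ n →
  F m r ≡ coeff (partialProduct (suc n)) (0ℤ , m , r)
F-partialProduct m r m≤n r≤n =
  -- The coefficient is constant from `suc (m ⊔ r)` factors on, so `suc n` of them are enough.
  sym (proj₂ (proj₂ (coeff-stabilises (0ℤ , m , r))) _ (s≤s (⊔-lub m≤n r≤n)))

-- The coefficient sum as the length of a list of rows

Admissible : ℕ → ℕ × ℕ → Set
Admissible n (m , r) = m + r ≡ n × m ≤ r

admissible? : ∀ n → U.Decidable (Admissible n)
admissible? n (m , r) = (m + r ≟ n) ×-dec (m ≤? r)

∈-admissiblePairs⁻ : ∀ {n e} → e ∈ admissiblePairs n → Admissible n e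
∈-admissiblePairs⁻ {n} e∈ = proj₂
  (∈-filter⁻ (admissible? n) {xs = cartesianProduct (upTo (suc n)) (upTo (suc n))} e∈)

∈-admissiblePairs⁺ : ∀ {n e} → Admissible n e → e ∈ admissiblePairs n
∈-admissiblePairs⁺ {n} {m , r} adm@(refl , _) = ∈-filter⁺ (admissible? n)
  (∈-cartesianProduct⁺ (∈-upTo⁺ (s≤s (m≤m+n m r))) (∈-upTo⁺ (s≤s (m≤n+m r m)))) adm

admissiblePairs-unique : ∀ n → Unique (admissiblePairs n)
admissiblePairs-unique n = Unique.filter⁺ (admissible? n)
  (Unique.cartesianProduct⁺ (Unique.upTo⁺ (suc n)) (Unique.upTo⁺ (suc n)))

HasExponent : ∀ {N} → (ℕ × ℕ) × Mask N → Set
HasExponent ((m , r) , p) = exponent (rows p) ≡ (0ℤ , m , r)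

hasExponent? : ∀ {N} → U.Decidable (HasExponent {N})
hasExponent? ((m , r) , p) = exponent (rows p) ≟ᴹ (0ℤ , m , r)

zFreeMasks : ∀ n → List ((ℕ × ℕ) × Mask (suc n))
zFreeMasks n = filter hasExponent? (cartesianProduct (admissiblePairs n) (masks (suc n)))

-- The pair (m , r) is determined by the rows; it is kept so that the list comes
-- straight from the double sum.
zFreeRows : ℕ → List ((ℕ × ℕ) × Rows)
zFreeRows n = map (map₂ rows) (zFreeMasks n)

sum-F : ∀ n → sumℤ (map (λ (m , r) → F m r) (admissiblePairs n)) ≡ + length (zFreeRows n)
sum-F n = begin
  sumℤ (map (λ (m , r) → F m r) (admissiblePairs n))
    -- Truncating to `suc n` factors uses that `m` and `r` are at most `n`, which membership in
    -- `admissiblePairs n` provides; hence the local congruence.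
    ≡⟨ cong sumℤ (List.map-cong-local (All.tabulate F-count)) ⟩
  sumℤ (map (λ e → + length (filter (λ p → hasExponent? (e , p)) (masks (suc n))))
            (admissiblePairs n))
    ≡⟨ sumℤ-length-filter hasExponent? (admissiblePairs n) (masks (suc n)) ⟩
  + length (zFreeMasks n)
    ≡⟨ cong +_ (List.length-map (map₂ rows) (zFreeMasks n)) ⟨
  + length (zFreeRows n) ∎
  where
  open ≡-Reasoning

  F-count : ∀ {e} → e ∈ admissiblePairs n → F (proj₁ e) (proj₂ e) ≡
            + length (filter (λ p → hasExponent? (e , p)) (masks (suc n)))
  F-count {m , r} e∈ with refl , _ ← ∈-admissiblePairs⁻ {n} e∈ =
    trans (F-partialProduct m r (m≤m+n m r) (m≤n+m r m))
          (coeff-partialProduct (suc n) (0ℤ , m , r))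

zFreeRows-unique : ∀ n → Unique (zFreeRows n)
zFreeRows-unique n = Unique.map⁺
  (λ eq → cong₂ _,_ (cong proj₁ eq) (rows-injective (cong proj₂ eq)))
  (Unique.filter⁺ hasExponent?
    (Unique.cartesianProduct⁺ (admissiblePairs-unique n) (masks-unique (suc n))))

-- Frobenius partitions

arrayRows : Array → Rows
arrayRows (_ , a , b) = toList a , toList b

qxWeights : Array → ℕ × ℕ
qxWeights (k , a , b) = k + Vec.sum a , Vec.sum b

tagged : Array → (ℕ × ℕ) × Rows
tagged π = qxWeights π , arrayRows π

-- The width is recovered as the length of the top row; once the widths agree, the lists determine
-- the vectors.
tagged-injective : ∀ {π π′} → tagged π ≡ tagged π′ → π ≡ π′
tagged-injective {k , a , b} {k′ , a′ , b′} eq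
  with refl ← trans (sym (Vec.length-toList a))
                (trans (cong (length ∘ proj₁ ∘ proj₂) eq) (Vec.length-toList a′)) =
  cong₂ (λ a b → k , a , b) (toList-injective a a′ (cong (proj₁ ∘ proj₂) eq))
                            (toList-injective b b′ (cong (proj₂ ∘ proj₂) eq))

-- Both rows have length `k`, so the power of `z` cancels.
exponent-arrayRows : ∀ π → exponent (arrayRows π) ≡ (0ℤ , qxWeights π)
exponent-arrayRows (k , a , b)
  rewrite Vec.length-toList a | Vec.length-toList b | sum-toList a | sum-toList b =
  cong (_, (k + Vec.sum a , Vec.sum b)) (ℤ.n⊖n≡0 k)

-- The first entry is at most the sum of the row, hence below `suc n`.
Linked-bound : ∀ {n k} (a : Vec ℕ k) → Vec.sum a ≤ n → Linked _>_ a →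
  Linked _>_ (suc n ∷ a)
Linked-bound []      _ _ = [-]
Linked-bound (x ∷ a) h l = s≤s (m+n≤o⇒m≤o x h) ∷ l

counted⇒∈ : ∀ {n} π → Counted n π → tagged π ∈ zFreeRows n
counted⇒∈ {n} π@(k , a , b) ((la , lb) , refl , le)
  with u , eqᵘ ← Linked⇒decode (suc n) a
                   (Linked-bound a (≤-trans (m≤n+m _ k) (m≤m+n _ _)) la)
     | v , eqᵛ ← Linked⇒decode (suc n) b (Linked-bound b (m≤n+m _ _) lb) =
  subst (λ t → (qxWeights π , t) ∈ zFreeRows n) rows≡
    (∈-map⁺ (map₂ rows) (∈-filter⁺ hasExponent?
      (∈-cartesianProduct⁺ (∈-admissiblePairs⁺ (refl , le)) (∈-masks (u , v)))
      (trans (cong exponent rows≡) (exponent-arrayRows π))))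
  where
  rows≡ : rows (u , v) ≡ arrayRows π
  rows≡ = cong₂ _,_ eqᵘ eqᵛ

⊖≡0⇒≡ : ∀ m n → m ⊖ n ≡ 0ℤ → m ≡ n
⊖≡0⇒≡ m n eq = ℤ.+-injective (ℤ.i-j≡0⇒i≡j (+ m) (+ n) (trans (ℤ.m-n≡m⊖n m n) eq))

-- A vanishing power of `z` makes the two rows equally long, so they form an array whose `qxWeights`
-- are the powers of `q` and `x`.
∈⇒counted : ∀ {n z} → z ∈ zFreeRows n → ∃ λ π → Counted n π × z ≡ tagged π
∈⇒counted {n} z∈
  with ((m , r) , u , v) , w∈ , refl ← ∈-map⁻ (map₂ rows) z∈
  with w∈′ , exp≡ ← ∈-filter⁻ hasExponent?
                      {xs = cartesianProduct (admissiblePairs n) (masks (suc n))} w∈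
  with e∈ , _ ← ∈-cartesianProduct⁻ (admissiblePairs n) (masks (suc n)) w∈′
  -- This `refl` fixes the width as the length of the top row.
  with a , eqᵃ ← toList-surjective (decode u) refl
  with b , eqᵇ ← toList-surjective (decode v)
                   (sym (⊖≡0⇒≡ (length (decode u)) _ (cong proj₁ exp≡)))
  -- `Admissible n (qxWeights π)` unfolds to the weight condition and the inequality in
  -- `Counted n π`.
  = π , (frobenius , subst (Admissible n) weights≡ (∈-admissiblePairs⁻ {n} e∈)) ,
    cong₂ _,_ weights≡ (sym rows≡)
  where
  π : Array
  π = _ , a , b

  rows≡ : arrayRows π ≡ rows (u , v)
  rows≡ = cong₂ _,_ eqᵃ eqᵇ

  weights≡ : (m , r) ≡ qxWeights π
  weights≡ = cong proj₂
    (trans (sym exp≡) (trans (cong exponent (sym rows≡)) (exponent-arrayRows π)))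

  frobenius : IsFrobenius π
  frobenius = Linked.tail (decode⇒Linked a u eqᵃ) , Linked.tail (decode⇒Linked b v eqᵇ)

-- Equality of the two counts

counted-irrelevant : ∀ n → U.Irrelevant (Counted n)
counted-irrelevant n ((p , q) , r , s) ((p′ , q′) , r′ , s′) =
  cong₂ _,_
    (cong₂ _,_ (Linked.irrelevant ≤-irrelevant p p′) (Linked.irrelevant ≤-irrelevant q q′))
    (cong₂ _,_ (≡-irrelevant r r′) (≤-irrelevant s s′))

module _ (n : ℕ) where
  private
    open Inverse (proj₂ (counted-finite n)) using (to; from; strictlyInverseˡ)

    tag : Fin (f n) → (ℕ × ℕ) × Rows
    tag i = tagged (proj₁ (to i))

  tag-injective : ∀ {i j} → tag i ≡ tag j → i ≡ j
  tag-injective {i} {j} eq = Injection.injective (↔⇒↣ (proj₂ (counted-finite n)))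
    (subtype-≡ (tagged-injective eq))
    where
    subtype-≡ : ∀ {π π′ : ∃ (Counted n)} → proj₁ π ≡ proj₁ π′ → π ≡ π′
    subtype-≡ {π , _} refl = cong (π ,_) (counted-irrelevant n _ _)

  -- Through its defining bijection `f n` is the length of `tabulate tag`; that list and
  -- `zFreeRows n` have no repetitions and the same elements.
  f-count : f n ≡ length (zFreeRows n)
  f-count = trans (sym (List.length-tabulate tag))
    (length-unique (Unique.tabulate⁺ tag-injective) (zFreeRows-unique n) ⊆ ⊇)
    where
    ⊆ : ∀ {z} → z ∈ tabulate tag → z ∈ zFreeRows n
    ⊆ z∈ with i , refl ← ∈-tabulate⁻ z∈ = counted⇒∈ _ (proj₂ (to i))

    ⊇ : ∀ {z} → z ∈ zFreeRows n → z ∈ tabulate tag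
    ⊇ z∈ with π , c , refl ← ∈⇒counted z∈ =
      -- The index of `π` is given by `from`, and the round trip through `to` restores `π`.
      subst (λ s → tagged (proj₁ s) ∈ tabulate tag) (strictlyInverseˡ (π , c))
        (∈-tabulate⁺ (from (π , c)))

mainTheorem2 : (n : ℕ) → + (f n) ≡ sumℤ (map (λ (m , r) → F m r) (admissiblePairs n))
mainTheorem2 n = trans (cong +_ (f-count n)) (sym (sum-F n))
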